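{- The following relations are well-founded: the relation $<_{\mathsf t}$ on terms; the relation $<_{p\times g}$ on pairs (pattern, grammar); and, consequently, for every grammar $g$, the relation $<^{g}_{t\times p\times g}$ on triples (term, pattern, grammar), which is the lexicographic product of $<_{\mathsf t}$ and $<_{p\times g}$: $$(t',p',G')<^{g}_{t\times p\times g}(t,p,G)\iff t'<_{\mathsf t}t\ \ \vee\ \ \bigl(t'=t\wedge (p',G')<_{p\times g}(p,G)\bigr).$$
   Context: **Terms and patterns.** Fix sets of literals $a$, pattern variables $x$ and non-terminals $n$, each with decidable equality. Terms $t$, list terms $l$, contexts $C$ and list contexts $L$ are mutually inductively generated by $t ::= \mathsf{lit}\,a \mid l \mid C$; $l ::= \mathsf{nil}\mid \mathsf{cons}\;t\;l$; $C ::= \mathsf{hole}\mid L$; $L ::= \mathsf{hd}\;C\;l \mid \mathsf{tl}\;t\;L$ (injections between categories are left implicit). Patterns $p$ and list patterns $q$: $p ::= \mathsf{lit}\,a\mid \mathsf{hole}\mid q\mid \mathsf{name}\,x\,p\mid \mathsf{nt}\,n\mid \mathsf{in\text{ - }hole}\,p_c\,p_h$; $q::=\mathsf{nil}\mid\mathsf{cons}\;p\;q$. A term is structured if it is $\mathsf{cons}\;t_1\;l$, with head $t_1$ and tail $l$; or $\mathsf{hd}\;C\;l$, with head $C$ and tail $l$; or $\mathsf{tl}\;t_1\;L$, with head $t_1$ and tail $L$ (heads and tails viewed as terms). The relation $<_{\mathsf t}$ is the proper sub-term relation: the transitive closure of "$t'$ is the head or the tail of the structured term $t$". A production is a pair $(n,p)$.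 A grammar $G$ is a finite set of productions; $p\in G(n)$ means $(n,p)\in G$; $G\setminus(n,p)$ is $G$ with $(n,p)$ removed. $<_{p\times g}$ is the least relation on pairs (pattern, grammar) with: $(p_c,G)<_{p\times g}(\mathsf{in\text{ - }hole}\,p_c\,p_h,G)$; $(p_h,G)<_{p\times g}(\mathsf{in\text{ - }hole}\,p_c\,p_h,G)$; $(p,G)<_{p\times g}(\mathsf{name}\,x\,p,G)$; and $(p,G\setminus(n,p))<_{p\times g}(\mathsf{nt}\,n,G)$ whenever $p\in G(n)$. A relation $R$ is well-founded if every element is accessible for $R$, where accessibility is the least predicate such that $a$ is accessible whenever all $b$ with $b\mathrel{R}a$ are accessible. The parameter $g$ records the original grammar and does not appear in the condition defining $<^{g}_{t\times p\times g}$. -}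

module Defs where

open import Data.List.Base using (List; filter)
open import Data.List.Membership.Propositional using (_∈_)
open import Data.List.Relation.Binary.BagAndSetEquality using (_∼[_]_; set)
open import Data.Product.Base using (_×_; _,_)
open import Data.Product.Properties using (≡-dec)
open import Data.Product.Relation.Binary.Lex.Strict using (×-Lex)
open import Level using (0ℓ)
open import Relation.Binary.Construct.Closure.Transitive using (TransClosure)
open import Relation.Binary.Core using (Rel)
open import Relation.Binary.Definitions using (DecidableEquality)
open import Relation.Binary.PropositionalEquality.Core using (_≡_; refl)
open import Relation.Nullary.Decidable using (yes; no; ¬?; map′; _×-dec_)

module Language
  (Lit Var NonTerm : Set)
  (_≟ˡ_ : DecidableEquality Lit)
  (_≟ᵛ_ : DecidableEquality Var)
  (_≟ⁿ_ : DecidableEquality NonTerm)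
  where

  infix 4 _◂_ _<t_ _<p×g_ _≟ᵖ_ _≟ᵠ_ _≟ᵖʳ_ _≋_
  infixl 6 _∖_

  data Term     : Set
  data ListTerm : Set
  data Ctx      : Set
  data ListCtx  : Set

  data Term where
    lit  : Lit → Term
    list : ListTerm → Term
    ctx  : Ctx → Term

  data ListTerm where
    nil  : ListTerm
    cons : Term → ListTerm → ListTerm

  data Ctx where
    hole : Ctx
    list : ListCtx → Ctx

  data ListCtx where
    hd : Ctx → ListTerm → ListCtx
    tl : Term → ListCtx → ListCtx

  data Pattern     : Set
  data ListPattern : Set

  data Pattern where
    lit     : Lit → Pattern
    hole    : Pattern
    list    : ListPattern → Pattern
    name    : Var → Pattern → Pattern
    nt      : NonTerm → Pattern
    in-hole : (pc ph : Pattern) → Pattern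

  data ListPattern where
    nil  : ListPattern
    cons : Pattern → ListPattern → ListPattern

  _≟ᵖ_ : DecidableEquality Pattern
  _≟ᵠ_ : DecidableEquality ListPattern

  (lit x) ≟ᵖ (lit x′) =
    map′ (λ { refl → refl }) (λ { refl → refl }) (x ≟ˡ x′)
  (lit _) ≟ᵖ hole = no λ ()
  (lit _) ≟ᵖ (list _) = no λ ()
  (lit _) ≟ᵖ (name _ _) = no λ ()
  (lit _) ≟ᵖ (nt _) = no λ ()
  (lit _) ≟ᵖ (in-hole _ _) = no λ ()
  hole ≟ᵖ (lit _) = no λ ()
  hole ≟ᵖ hole = yes refl
  hole ≟ᵖ (list _) = no λ ()
  hole ≟ᵖ (name _ _) = no λ ()
  hole ≟ᵖ (nt _) = no λ ()
  hole ≟ᵖ (in-hole _ _) = no λ ()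
  (list _) ≟ᵖ (lit _) = no λ ()
  (list _) ≟ᵖ hole = no λ ()
  (list x) ≟ᵖ (list x′) =
    map′ (λ { refl → refl }) (λ { refl → refl }) (x ≟ᵠ x′)
  (list _) ≟ᵖ (name _ _) = no λ ()
  (list _) ≟ᵖ (nt _) = no λ ()
  (list _) ≟ᵖ (in-hole _ _) = no λ ()
  (name _ _) ≟ᵖ (lit _) = no λ ()
  (name _ _) ≟ᵖ hole = no λ ()
  (name _ _) ≟ᵖ (list _) = no λ ()
  (name x y) ≟ᵖ (name x′ y′) =
    map′ (λ { (refl , refl) → refl }) (λ { refl → refl , refl })
      (x ≟ᵛ x′ ×-dec y ≟ᵖ y′)
  (name _ _) ≟ᵖ (nt _) = no λ ()
  (name _ _) ≟ᵖ (in-hole _ _) = no λ ()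
  (nt _) ≟ᵖ (lit _) = no λ ()
  (nt _) ≟ᵖ hole = no λ ()
  (nt _) ≟ᵖ (list _) = no λ ()
  (nt _) ≟ᵖ (name _ _) = no λ ()
  (nt x) ≟ᵖ (nt x′) =
    map′ (λ { refl → refl }) (λ { refl → refl }) (x ≟ⁿ x′)
  (nt _) ≟ᵖ (in-hole _ _) = no λ ()
  (in-hole _ _) ≟ᵖ (lit _) = no λ ()
  (in-hole _ _) ≟ᵖ hole = no λ ()
  (in-hole _ _) ≟ᵖ (list _) = no λ ()
  (in-hole _ _) ≟ᵖ (name _ _) = no λ ()
  (in-hole _ _) ≟ᵖ (nt _) = no λ ()
  (in-hole x y) ≟ᵖ (in-hole x′ y′) =
    map′ (λ { (refl , refl) → refl }) (λ { refl → refl , refl })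
      (x ≟ᵖ x′ ×-dec y ≟ᵖ y′)

  nil ≟ᵠ nil = yes refl
  nil ≟ᵠ (cons _ _) = no λ ()
  (cons _ _) ≟ᵠ nil = no λ ()
  (cons x y) ≟ᵠ (cons x′ y′) =
    map′ (λ { (refl , refl) → refl }) (λ { refl → refl , refl })
      (x ≟ᵖ x′ ×-dec y ≟ᵠ y′)

  -- t′ ◂ t : t is structured and t′ is its head or its tail.
  data _◂_ : Rel Term 0ℓ where
    cons-head : ∀ {t l} → t ◂ list (cons t l)
    cons-tail : ∀ {t l} → list l ◂ list (cons t l)
    hd-head   : ∀ {C l} → ctx C ◂ ctx (list (hd C l))
    hd-tail   : ∀ {C l} → list l ◂ ctx (list (hd C l))
    tl-head   : ∀ {t L} → t ◂ ctx (list (tl t L))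
    tl-tail   : ∀ {t L} → ctx (list L) ◂ ctx (list (tl t L))

  _<t_ : Rel Term 0ℓ
  _<t_ = TransClosure _◂_

  Production : Set
  Production = NonTerm × Pattern

  _≟ᵖʳ_ : DecidableEquality Production
  _≟ᵖʳ_ = ≡-dec _≟ⁿ_ _≟ᵖ_

  -- A finite set of productions is a list of its elements; order and
  -- multiplicity are irrelevant, so equality of grammars is _≋_ (same
  -- elements) rather than _≡_.
  Grammar : Set
  Grammar = List Production

  _≋_ : Rel Grammar 0ℓ
  G ≋ G′ = G ∼[ set ] G′

  -- Removes every occurrence of the production, as set difference must.
  _∖_ : Grammar → Production → Grammar
  G ∖ r = filter (λ r′ → ¬? (r′ ≟ᵖʳ r)) G

  -- The premises G′ ≋ … make the relation one on grammars as sets, i.e.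
  -- invariant under _≋_ in both arguments.
  data _<p×g_ : Rel (Pattern × Grammar) 0ℓ where
    in-hole-ctx  : ∀ {pc ph G G′} → G′ ≋ G → (pc , G′) <p×g (in-hole pc ph , G)
    in-hole-hole : ∀ {pc ph G G′} → G′ ≋ G → (ph , G′) <p×g (in-hole pc ph , G)
    name         : ∀ {x p G G′} → G′ ≋ G → (p , G′) <p×g (name x p , G)
    nt           : ∀ {n p G G′} → (n , p) ∈ G → G′ ≋ G ∖ (n , p) →
                   (p , G′) <p×g (nt n , G)

  -- The original grammar g is only recorded; it does not affect the order.
  <t×p×g : Grammar → Rel (Term × Pattern × Grammar) 0ℓ
  <t×p×g g = ×-Lex _≡_ _<t_ _<p×g_

-- A grammar is bounded by a list L that contains all its productions; length L
-- then replaces the cardinality, since duplicates in the representation of the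
-- grammar do not matter. Unfolding nt removes a production from L and so
-- shortens it, and the other steps keep L and pass to a sub-pattern.

{-# OPTIONS --safe #-}
module Submission where

open import Defs
open import Data.List.Base using (length)
open import Data.List.Membership.Propositional using (_∈_; lose)
open import Data.List.Properties using (filter-notAll)
open import Data.List.Relation.Binary.Subset.Propositional using (_⊆_)
open import Data.List.Relation.Binary.Subset.Propositional.Properties
  using (⊆-refl; ⊆-trans; filter⁺′)
open import Data.Nat.Base using (_<_)
open import Data.Nat.Induction using (<-wellFounded)
open import Data.Product.Base using (_×_; _,_)
open import Data.Product.Relation.Binary.Lex.Strict using (×-wellFounded)
open import Function.Base using (_on_; id)
open import Function.Bundles using (Equivalence)
open import Induction.WellFounded using (Acc; acc; WfRec; WellFounded)
open import Relation.Binary.Construct.Closure.Transitive using (wellFounded)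
import Relation.Binary.Construct.On as On
open import Relation.Binary.Definitions using (DecidableEquality)
open import Relation.Binary.PropositionalEquality.Core using (refl)
open import Relation.Nullary.Decidable using (¬?)

module WellFoundedness
  (Lit Var NonTerm : Set)
  (_≟ˡ_ : DecidableEquality Lit)
  (_≟ᵛ_ : DecidableEquality Var)
  (_≟ⁿ_ : DecidableEquality NonTerm)
  where

  open Language Lit Var NonTerm _≟ˡ_ _≟ᵛ_ _≟ⁿ_

  -- Structural recursion across the mutual syntax: a head or tail stays structurally smaller even
  -- after being injected back into `Term`.
  ◂-wellFounded : WellFounded _◂_
  ◂-wellFounded t = acc (subterm t)
    where
    subterm : ∀ t → WfRec _◂_ (Acc _◂_) t
    subterm (list (cons t l))       cons-head = acc (subterm t)
    subterm (list (cons t l))       cons-tail = acc (subterm (list l))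
    subterm (ctx (list (hd C l)))   hd-head   = acc (subterm (ctx C))
    subterm (ctx (list (hd C l)))   hd-tail   = acc (subterm (list l))
    subterm (ctx (list (tl t L)))   tl-head   = acc (subterm t)
    subterm (ctx (list (tl t L)))   tl-tail   = acc (subterm (ctx (list L)))

  <t-wellFounded : WellFounded _<t_
  <t-wellFounded = wellFounded _ ◂-wellFounded

  ≋⇒⊆ : ∀ {G G′} → G ≋ G′ → G ⊆ G′
  ≋⇒⊆ G≋G′ = Equivalence.to G≋G′

  -- Lets the bound lose the same production as the grammar in an `nt` step.
  ∖-mono-⊆ : ∀ {G G′} r → G ⊆ G′ → G ∖ r ⊆ G′ ∖ r
  ∖-mono-⊆ r = filter⁺′ ≢r? ≢r? id
    where ≢r? = λ r′ → ¬? (r′ ≟ᵖʳ r)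

  -- The entry `r` itself fails the filter's test, so at least one entry is dropped.
  length-∖ : ∀ {r G} → r ∈ G → length (G ∖ r) < length G
  length-∖ {r} {G} r∈G =
    filter-notAll (λ r′ → ¬? (r′ ≟ᵖʳ r)) G (lose r∈G λ r≢r → r≢r refl)

  <p×g-wellFounded : WellFounded _<p×g_
  <p×g-wellFounded (p , G) =
    acc (bounded (On.wellFounded length <-wellFounded G) p ⊆-refl)
    where
    -- Lexicographic recursion: first on the accessibility of `L`, then on the pattern. `G` is left
    -- general because it may change along `≋` while `L` stays fixed.
    bounded : ∀ {L : Grammar} → Acc (_<_ on length) L →
              ∀ p {G} → G ⊆ L → WfRec _<p×g_ (Acc _<p×g_) (p , G)
    bounded a (in-hole pc ph) G⊆L (in-hole-ctx G′≋G) =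
      acc (bounded a pc (⊆-trans (≋⇒⊆ G′≋G) G⊆L))
    bounded a (in-hole pc ph) G⊆L (in-hole-hole G′≋G) =
      acc (bounded a ph (⊆-trans (≋⇒⊆ G′≋G) G⊆L))
    bounded a (name x p) G⊆L (name G′≋G) =
      acc (bounded a p (⊆-trans (≋⇒⊆ G′≋G) G⊆L))
    -- Here `p` comes from the grammar and may be larger than `nt n`, so the bound must decrease: it
    -- becomes `L ∖ (n , p)`, shorter because `G⊆L` puts the production in `L`.
    bounded (acc rec) (nt n) G⊆L (nt {p = p} r∈G G′≋G∖r) =
      acc (bounded (rec (length-∖ (G⊆L r∈G))) p
        (⊆-trans (≋⇒⊆ G′≋G∖r) (∖-mono-⊆ (n , p) G⊆L)))

mainTheorem5 : (Lit Var NonTerm : Set)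
    (_≟ˡ_ : DecidableEquality Lit)
    (_≟ᵛ_ : DecidableEquality Var)
    (_≟ⁿ_ : DecidableEquality NonTerm) →
    let open Language Lit Var NonTerm _≟ˡ_ _≟ᵛ_ _≟ⁿ_ in
    WellFounded _<t_
    × WellFounded _<p×g_
    × ((g : Grammar) → WellFounded (<t×p×g g))
mainTheorem5 Lit Var NonTerm _≟ˡ_ _≟ᵛ_ _≟ⁿ_ =
  <t-wellFounded , <p×g-wellFounded ,
  λ _ → ×-wellFounded <t-wellFounded <p×g-wellFounded
  where open WellFoundedness Lit Var NonTerm _≟ˡ_ _≟ᵛ_ _≟ⁿ_
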